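{- Let $n\ge 8$ be an even integer and let $W_{3,n}$ be the $3$-regular Kn\"odel graph. Then $W_{3,n}$ is $\gamma$-critical if and only if $n\equiv 4 \pmod 8$.
   Context: For an even integer $n\ge 2$ and $1\le\Delta\le\lfloor\log_2 n\rfloor$, the Kn\"odel graph $W_{\Delta,n}$ is the $\Delta$-regular bipartite graph on the $n$ vertices $(i,j)$, $i\in\{1,2\}$, $0\le j\le n/2-1$, in which for every $j$ the vertex $(1,j)$ is adjacent to the vertices $(2,(j+2^k-1)\bmod (n/2))$ for $k=0,1,\dots,\Delta-1$ (and there are no other edges); in particular $W_{3,n}$ is defined for even $n\ge 8$. A set $D$ of vertices of a graph $G$ is dominating if every vertex not in $D$ is adjacent to a vertex of $D$; $\gamma(G)$ is the minimum size of a dominating set. A graph $G$ is $\gamma$-critical (domination vertex critical) if $\gamma(G-u)<\gamma(G)$ for every vertex $u$ of $G$, where $G-u$ is the graph obtained by deleting $u$. -}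

module Defs where

open import Data.Fin.Base using (Fin; toℕ)
open import Data.Fin.Properties using (nonZeroIndex)
open import Data.List.Base using (List; length)
open import Data.List.Membership.Propositional using (_∈_; _∉_)
open import Data.List.Relation.Unary.Unique.Propositional using (Unique)
open import Data.Nat.Base using (ℕ; _+_; _∸_; _^_; _<_; _≤_)
open import Data.Nat.DivMod using (_/_; _mod_)
open import Data.Product.Base using (∃-syntax; Σ-syntax; _×_)
open import Data.Refinement.Base using (Refinement-syntax; value)
open import Data.Empty using (⊥)
open import Data.Sum.Base using (_⊎_; inj₁; inj₂)
open import Relation.Binary.Core using (Rel)
open import Relation.Binary.Definitions using (Symmetric)
open import Relation.Binary.PropositionalEquality.Core using (_≡_; _≢_)
open import Relation.Nullary.Negation.Core using (¬_)
open import Level using (0ℓ)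

record Graph : Set₁ where
  field
    Vertex     : Set
    Adj        : Rel Vertex 0ℓ
    Adj-sym    : Symmetric Adj
    Adj-irrefl : ∀ v → ¬ Adj v v

open Graph

-- The proof of v ≢ u is irrelevant, so two vertices of G - u are equal as soon
-- as they are equal in G; hence `Unique` lists below have the expected length.
infixl 6 _-_
_-_ : (G : Graph) → Vertex G → Graph
(G - u) .Vertex       = [ v ∈ Vertex G ∣ v ≢ u ]
(G - u) .Adj v w      = Adj G (value v) (value w)
(G - u) .Adj-sym      = Adj-sym G
(G - u) .Adj-irrefl v = Adj-irrefl G (value v)

-- Finite vertex sets are duplicate-free lists; their size is the length.
record IsDominatingSet (G : Graph) (D : List (Vertex G)) : Set where
  field
    unique    : Unique D
    dominates : ∀ v → v ∉ D → ∃[ d ] d ∈ D × Adj G v d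

-- γ(G) = m
record IsDominationNumber (G : Graph) (m : ℕ) : Set where
  field
    attained : ∃[ D ] IsDominatingSet G D × length D ≡ m
    minimal  : ∀ D → IsDominatingSet G D → m ≤ length D

-- γ(G - u) < γ(G) for every u, the domination numbers being determined
-- uniquely by `IsDominationNumber`.
DominationCritical : Graph → Set
DominationCritical G = (u : Vertex G) →
  ∃[ m ] ∃[ m′ ] IsDominationNumber G m × IsDominationNumber (G - u) m′ × m′ < m

-- The relation between j and j′ expressing that (1 , j) is adjacent to (2 , j′).
KnödelLink : (Δ n : ℕ) → Rel (Fin (n / 2)) 0ℓ
KnödelLink Δ n j j′ =
  Σ[ k ∈ Fin Δ ] j′ ≡ _mod_ (toℕ j + (2 ^ toℕ k ∸ 1)) (n / 2) {{nonZeroIndex j}}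

-- inj₁ j and inj₂ j are the vertices (1 , j) and (2 , j).  The definition makes
-- sense for all Δ and n, but is the Knödel graph W_{Δ,n} only for even n ≥ 2
-- and 1 ≤ Δ ≤ ⌊log₂ n⌋.
Knödel : (Δ n : ℕ) → Graph
Knödel Δ n = record
  { Vertex     = Fin (n / 2) ⊎ Fin (n / 2)
  ; Adj        = KAdj
  ; Adj-sym    = λ {v} {w} → KAdj-sym v w
  ; Adj-irrefl = λ { (inj₁ _) () ; (inj₂ _) () }
  }
  where
  KAdj : Rel (Fin (n / 2) ⊎ Fin (n / 2)) 0ℓ
  KAdj (inj₁ j) (inj₂ j′) = KnödelLink Δ n j j′
  KAdj (inj₂ j) (inj₁ j′) = KnödelLink Δ n j′ j
  KAdj (inj₁ _) (inj₁ _)  = ⊥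
  KAdj (inj₂ _) (inj₂ _)  = ⊥

  KAdj-sym : ∀ v w → KAdj v w → KAdj w v
  KAdj-sym (inj₁ _) (inj₂ _) link = link
  KAdj-sym (inj₂ _) (inj₁ _) link = link

{-# OPTIONS --safe #-}
-- Unroll W_{3,n} along ℕ, writing P t and Q t for the vertices of index t on its
-- two sides, so that P t is adjacent to Q t, Q (1 + t) and Q (3 + t).  With
-- m = n / 2, the closed neighbourhoods of P (1 + 4i) and Q (3 + 4i), i < q,
-- together tile exactly the P t and Q (1 + t) with t < 4q.  For m = 4q or
-- m = 4q + 3 these tiles (with i ≤ q in the latter case), and for m = 4q + 1
-- the tiles and P (4q), give a dominating set D with 4|D| < 2m + 3.  As a set E
-- dominating all but one vertex satisfies 2m ≤ 4|E| + 1, criticality fails.  For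
-- m = 4q + 2 the tiles and P (1 + 4q) miss only P (4q), which can be any vertex,
-- so 2q + 1 vertices dominate G - u, as few as the count allows.  They do not
-- dominate G: with a vertices of D on one side and b on the other, 3a + b and
-- a + 3b are at least 4q + 2; if |D| ≤ 2q + 1, this forces a, b ≥ q + 1.
module Submission where

open import Defs
open import Data.Empty using (⊥-elim-irr)
open import Data.Fin.Base using (Fin; zero; suc; toℕ; fromℕ<)
open import Data.Fin.Properties
  using (nonZeroIndex; toℕ-injective; toℕ-fromℕ<; toℕ<n; injective⇒≤)
  renaming (_≟_ to _≟ᶠ_)
open import Data.Irrelevant using ([_])
open import Data.List.Base
  using (List; []; _∷_; _++_; map; length; concatMap; upTo; deduplicate)
import Data.List.Membership.DecPropositional as DecMembership
open import Data.List.Membership.Propositional using (_∈_; _∉_; lose)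
open import Data.List.Membership.Propositional.Properties
  using (∈-deduplicate⁺; ∈-concatMap⁺; ∈-upTo⁺; ∈-map⁺; ∈-++⁺ˡ; ∈-++⁺ʳ)
import Data.List.Membership.Setoid.Properties as SetoidMembership
open import Data.List.Properties using (length-++; length-map; length-upTo; length-deduplicate)
open import Data.List.Relation.Unary.All as All using (All)
open import Data.List.Relation.Unary.All.Properties using (¬Any⇒All¬)
open import Data.List.Relation.Unary.Any as Any using (here; there)
open import Data.List.Relation.Unary.Unique.DecPropositional.Properties using (deduplicate-!)
open import Data.Nat.Base
  using (ℕ; zero; suc; _+_; _*_; _∸_; _≤_; _<_; NonZero; z≤n; s≤s; s≤s⁻¹)
open import Data.Nat.Divisibility using (_∣_)
open import Data.Nat.DivMod
  using (_/_; _%_; _mod_; _divMod_; result; %-distribˡ-+; m%n%n≡m%n; [m+kn]%n≡m%n; m<n⇒m%n≡m;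
         m%n<n; m/n*n≡m; /-monoˡ-≤; m≡m%n+[m/n]*n; m%n*o≡m*o%[n*o])
open import Data.Nat.Properties
open import Data.Nat.Tactic.RingSolver using (solve-∀)
open import Data.Product.Base using (∃-syntax; _×_; _,_)
open import Data.Refinement.Base using (_,_; value)
open import Data.Refinement.Properties using (value-injective) renaming (_≟_ to ≟ʳ)
open import Data.Sum.Base using (_⊎_; inj₁; inj₂)
open import Data.Sum.Properties using (≡-dec)
open import Function.Bundles using (_⇔_; Equivalence; mk⇔)
open import Relation.Binary.Definitions using (DecidableEquality; tri<; tri≈; tri>)
open import Relation.Binary.PropositionalEquality
  using (_≡_; _≢_; refl; sym; trans; cong; cong₂; subst; subst₂; setoid; module ≡-Reasoning)
open import Relation.Nullary using (¬_; yes; no; contradiction)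

open Graph

-- Domination by lists, and vertex deletion

Dominated : (G : Graph) → List (Vertex G) → Vertex G → Set
Dominated G D v = v ∈ D ⊎ (∃[ d ] d ∈ D × Adj G v d)

-- Repetitions are allowed, in contrast to `IsDominatingSet`, so explicit lists need no proof of
-- distinctness; deduplication never lengthens them.
Dominates : (G : Graph) → List (Vertex G) → Set
Dominates G D = ∀ v → Dominated G D v

DominatesExcept : (G : Graph) → Vertex G → List (Vertex G) → Set
DominatesExcept G u D = ∀ v → v ≢ u → Dominated G D v

module _ (G : Graph) (_≟_ : DecidableEquality (Vertex G)) where

  open DecMembership _≟_ using (_∈?_)
  open IsDominatingSet
  open IsDominationNumber

  isDominatingSet⇒Dominates : ∀ {D} → IsDominatingSet G D → Dominates G D
  isDominatingSet⇒Dominates {D} dom v with v ∈? D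
  ... | yes v∈D = inj₁ v∈D
  ... | no  v∉D = inj₂ (dominates dom v v∉D)

  deduplicate-isDominatingSet : ∀ {D} → Dominates G D → IsDominatingSet G (deduplicate _≟_ D)
  deduplicate-isDominatingSet {D} dom .unique = deduplicate-! _≟_ D
  deduplicate-isDominatingSet {D} dom .dominates v v∉ with dom v
  ... | inj₁ v∈D             = contradiction (∈-deduplicate⁺ _≟_ v∈D) v∉
  ... | inj₂ (d , d∈D , adj) = d , ∈-deduplicate⁺ _≟_ d∈D , adj

  -- The lower bound also applies to the deduplicated `D`, which pins its length to exactly `k`.
  mkIsDominationNumber : ∀ k D → Dominates G D → length D ≤ k →
    (∀ E → Dominates G E → k ≤ length E) → IsDominationNumber G k
  mkIsDominationNumber k D dom D≤k lower .attained =
    deduplicate _≟_ D , deduplicate-isDominatingSet dom ,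
    ≤-antisym (≤-trans (length-deduplicate _≟_ D) D≤k)
              (lower _ (isDominatingSet⇒Dominates (deduplicate-isDominatingSet dom)))
  mkIsDominationNumber k D dom D≤k lower .minimal E domE = lower E (isDominatingSet⇒Dominates domE)

  module _ (u : Vertex G) where

    map-value-dominates : ∀ {D} → Dominates (G - u) D → DominatesExcept G u (map value D)
    map-value-dominates dom v v≢u with dom (v , [ v≢u ])
    ... | inj₁ v∈D             = inj₁ (∈-map⁺ value v∈D)
    ... | inj₂ (d , d∈D , adj) = inj₂ (value d , ∈-map⁺ value d∈D , adj)

    restrict : ∀ {D} → All (_≢ u) D → List (Vertex (G - u))
    restrict = All.reduce (λ {v} v≢u → v , [ v≢u ])

    length-restrict : ∀ {D} (p : All (_≢ u) D) → length (restrict p) ≡ length D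
    length-restrict All.[]      = refl
    length-restrict (_ All.∷ p) = cong suc (length-restrict p)

    ∈-restrict : ∀ {D} (p : All (_≢ u) D) {v} → value v ∈ D → v ∈ restrict p
    ∈-restrict (_ All.∷ p) (here eq)   = here (value-injective eq)
    ∈-restrict (_ All.∷ p) (there v∈D) = there (∈-restrict p v∈D)

    restrict-dominates : ∀ {D} (p : All (_≢ u) D) → DominatesExcept G u D →
      Dominates (G - u) (restrict p)
    -- The stored `v≢u` is irrelevant and can only refute an equality; deciding `v ≟ u` yields a
    -- relevant proof to pass to `dom`.
    restrict-dominates p dom (v , [ v≢u ]) with v ≟ u
    ... | yes v≡u = ⊥-elim-irr (v≢u v≡u)
    ... | no v≢u′ with dom v v≢u′
    ...   | inj₁ v∈D             = inj₁ (∈-restrict p v∈D)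
    ...   | inj₂ (d , d∈D , adj) =
              inj₂ ((d , [ All.lookup p d∈D ]) , ∈-restrict p d∈D , adj)

-- Counting a cover, and blocks of four indices

covering⇒≤-length : ∀ {m} (xs : List (Fin m)) → (∀ i → i ∈ xs) → m ≤ length xs
-- A position in `xs` determines its entry, so sending `i` to its position is injective.
covering⇒≤-length xs cover = injective⇒≤ {f = λ i → Any.index (cover i)}
  (λ {i} {j} → SetoidMembership.index-injective (setoid _) (cover i) (cover j))

-- Splits the indices below `m` into `q` complete blocks and a remainder of `r` indices.
block-< : ∀ {s i r} q → s + i * 4 < r + q * 4 → r ≤ 4 → i < q ⊎ (i ≡ q × s < r)
block-< {s} {i} {r} q lt r≤4 with <-cmp i q
... | tri< i<q _ _  = inj₁ i<q
... | tri≈ _ refl _ = inj₂ (refl , +-cancelʳ-< (i * 4) s r lt)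
... | tri> _ _ q<i  = contradiction lt (≤⇒≯ (begin
  r + q * 4    ≤⟨ +-monoˡ-≤ (q * 4) r≤4 ⟩
  suc q * 4    ≤⟨ *-monoˡ-≤ 4 q<i ⟩
  i * 4        ≤⟨ m≤n+m (i * 4) s ⟩
  s + i * 4    ∎))
  where
  open ≤-Reasoning

-- Unrolled graphs and their tilings

record Frame (G : Graph) (m : ℕ) : Set where
  field
    P Q   : ℕ → Vertex G
    adj₀  : ∀ t → Adj G (P t) (Q t)
    adj₁  : ∀ t → Adj G (P t) (Q (1 + t))
    adj₃  : ∀ t → Adj G (P t) (Q (3 + t))
    -- The shift of `Q` by one matches the tiles: those of a block fill `P` at offsets 0 to 3 but
    -- `Q` at offsets 1 to 4.
    cover : ∀ v → ∃[ t ] t < m × (v ≡ P t ⊎ v ≡ Q (suc t))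

  tile : ℕ → ℕ → List (Vertex G)
  tile a b = map (λ i → P (1 + i * 4)) (upTo a) ++ map (λ i → Q (3 + i * 4)) (upTo b)

  length-tile : ∀ a b → length (tile a b) ≡ a + b
  length-tile a b = trans (length-++ (map _ (upTo a)))
    (cong₂ _+_ (trans (length-map _ (upTo a)) (length-upTo a))
               (trans (length-map _ (upTo b)) (length-upTo b)))

  module _ {a b : ℕ} where

    P∈tile : ∀ {i} → i < a → P (1 + i * 4) ∈ tile a b
    P∈tile i<a = ∈-++⁺ˡ (∈-map⁺ (λ i → P (1 + i * 4)) (∈-upTo⁺ i<a))

    Q∈tile : ∀ {i} → i < b → Q (3 + i * 4) ∈ tile a b
    Q∈tile i<b = ∈-++⁺ʳ (map _ (upTo a)) (∈-map⁺ (λ i → Q (3 + i * 4)) (∈-upTo⁺ i<b))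

    -- Offset 1 is the centre of the companion tile, whose presence depends on `a`. The two bounds
    -- stay separate because the last block may have a `P` tile without a `Q` tile.
    P-dominated : ∀ {i} → i < b → (s : Fin 4) → s ≢ suc zero →
      Dominated G (tile a b) (P (toℕ s + i * 4))
    P-dominated i<b zero                   _ = inj₂ (_ , Q∈tile i<b , adj₃ _)
    P-dominated i<b (suc zero)             c = contradiction refl c
    P-dominated i<b (suc (suc zero))       _ = inj₂ (_ , Q∈tile i<b , adj₁ _)
    P-dominated i<b (suc (suc (suc zero))) _ = inj₂ (_ , Q∈tile i<b , adj₀ _)

    Q-dominated : ∀ {i} → i < a → (s : Fin 4) → s ≢ suc (suc zero) →
      Dominated G (tile a b) (Q (suc (toℕ s + i * 4)))
    Q-dominated i<a zero                   _ = inj₂ (_ , P∈tile i<a , Adj-sym G (adj₀ _))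
    Q-dominated i<a (suc zero)             _ = inj₂ (_ , P∈tile i<a , Adj-sym G (adj₁ _))
    Q-dominated i<a (suc (suc zero))       c = contradiction refl c
    Q-dominated i<a (suc (suc (suc zero))) _ = inj₂ (_ , P∈tile i<a , Adj-sym G (adj₃ _))

    P-dominated′ : ∀ {i} → i < a → i < b → (s : Fin 4) →
      Dominated G (tile a b) (P (toℕ s + i * 4))
    P-dominated′ i<a i<b s with s ≟ᶠ suc zero
    ... | yes refl = inj₁ (P∈tile i<a)
    ... | no  s≢1  = P-dominated i<b s s≢1

    Q-dominated′ : ∀ {i} → i < a → i < b → (s : Fin 4) →
      Dominated G (tile a b) (Q (suc (toℕ s + i * 4)))
    Q-dominated′ i<a i<b s with s ≟ᶠ suc (suc zero)
    ... | yes refl = inj₁ (Q∈tile i<b)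
    ... | no  s≢2  = Q-dominated i<a s s≢2

  -- Only indices below `m` have to be reached, so the last block may be incomplete, as happens for
  -- `m = 4q + 3`.
  tile-dominates : ∀ a → m ≤ a * 4 → Dominates G (tile a a)
  tile-dominates a m≤4a v with cover v
  ... | t , t<m , eq with t divMod 4
  ...   | result i s refl = case (block-< a (<-≤-trans t<m m≤4a) z≤n) eq
    where
    case : i < a ⊎ (i ≡ a × toℕ s < 0) → v ≡ P (toℕ s + i * 4) ⊎ v ≡ Q (suc (toℕ s + i * 4)) →
      Dominated G (tile a a) v
    case (inj₁ i<a) (inj₁ refl) = P-dominated′ i<a i<a s
    case (inj₁ i<a) (inj₂ refl) = Q-dominated′ i<a i<a s

  Dominated-∷ : ∀ {D v} d → Dominated G D v → Dominated G (d ∷ D) v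
  Dominated-∷ d (inj₁ v∈D)             = inj₁ (there v∈D)
  Dominated-∷ d (inj₂ (e , e∈D , adj)) = inj₂ (e , there e∈D , adj)

  -- The leftover vertices `P (q * 4)` and `Q (1 + q * 4)` are adjacent, so one extra vertex handles
  -- both.
  tile-dominates₁ : ∀ q → m ≤ 1 + q * 4 → Dominates G (P (q * 4) ∷ tile q q)
  tile-dominates₁ q m≤ v with cover v
  ... | t , t<m , eq with t divMod 4
  ...   | result i s refl = case s (block-< q (<-≤-trans t<m m≤) (s≤s z≤n)) eq
    where
    case : ∀ s → i < q ⊎ (i ≡ q × toℕ s < 1) →
      v ≡ P (toℕ s + i * 4) ⊎ v ≡ Q (suc (toℕ s + i * 4)) →
      Dominated G (P (q * 4) ∷ tile q q) v
    case s    (inj₁ i<q)                 (inj₁ refl) = Dominated-∷ _ (P-dominated′ i<q i<q s)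
    case s    (inj₁ i<q)                 (inj₂ refl) = Dominated-∷ _ (Q-dominated′ i<q i<q s)
    case zero (inj₂ (refl , _))          (inj₁ refl) = inj₁ (here refl)
    case zero (inj₂ (refl , _))          (inj₂ refl) = inj₂ (_ , here refl , Adj-sym G (adj₁ _))
    case (suc _) (inj₂ (_ , s≤s ())) _

  -- Of the four leftover vertices, the tile around `P (1 + q * 4)` contains its centre and both
  -- `Q`s.
  tile-dominates₂ : ∀ q → m ≤ 2 + q * 4 → DominatesExcept G (P (q * 4)) (tile (suc q) q)
  tile-dominates₂ q m≤ v v≢u with cover v
  ... | t , t<m , eq with t divMod 4
  ...   | result i s refl = case s (block-< q (<-≤-trans t<m m≤) (s≤s (s≤s z≤n))) eq
    where
    case : ∀ s → i < q ⊎ (i ≡ q × toℕ s < 2) →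
      v ≡ P (toℕ s + i * 4) ⊎ v ≡ Q (suc (toℕ s + i * 4)) →
      Dominated G (tile (suc q) q) v
    case s          (inj₁ i<q)        (inj₁ refl) = P-dominated′ (m<n⇒m<1+n i<q) i<q s
    case s          (inj₁ i<q)        (inj₂ refl) = Q-dominated′ (m<n⇒m<1+n i<q) i<q s
    case zero       (inj₂ (refl , _)) (inj₁ refl) = contradiction refl v≢u
    case (suc zero) (inj₂ (refl , _)) (inj₁ refl) = inj₁ (P∈tile (n<1+n q))
    case zero       (inj₂ (refl , _)) (inj₂ refl) = Q-dominated (n<1+n q) zero λ ()
    case (suc zero) (inj₂ (refl , _)) (inj₂ refl) = Q-dominated (n<1+n q) (suc zero) λ ()
    case (suc (suc _)) (inj₂ (_ , s≤s (s≤s ()))) _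

-- Index arithmetic modulo `n / 2`

module _ (n : ℕ) where

  private
    m = n / 2
    G = Knödel 3 n

    variable
      j : Fin (n / 2)

  _≟ⱽ_ : DecidableEquality (Vertex G)
  _≟ⱽ_ = ≡-dec _≟ᶠ_ _≟ᶠ_

  infixl 6 _⊕_ _⊖_

  _⊕_ : Fin m → ℕ → Fin m
  j ⊕ c = _mod_ (toℕ j + c) m {{nonZeroIndex j}}

  -- Since `m ∸ 1` represents -1 modulo `m`, subtraction becomes a case of `_⊕_` and inherits its
  -- laws.
  _⊖_ : Fin m → ℕ → Fin m
  j ⊖ c = j ⊕ c * (m ∸ 1)

  toℕ-⊕ : ∀ (j : Fin m) c .{{_ : NonZero m}} → toℕ (j ⊕ c) ≡ (toℕ j + c) % m
  toℕ-⊕ j c = toℕ-fromℕ< (m%n<n (toℕ j + c) m {{nonZeroIndex j}})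

  ⊕-⊕ : ∀ (j : Fin m) a b → j ⊕ a ⊕ b ≡ j ⊕ (a + b)
  ⊕-⊕ j a b = toℕ-injective (begin
    toℕ (j ⊕ a ⊕ b)                       ≡⟨ toℕ-⊕ (j ⊕ a) b ⟩
    (toℕ (j ⊕ a) + b) % m                 ≡⟨ cong (λ x → (x + b) % m) (toℕ-⊕ j a) ⟩
    ((toℕ j + a) % m + b) % m             ≡⟨ %-distribˡ-+ ((toℕ j + a) % m) b m ⟩
    ((toℕ j + a) % m % m + b % m) % m     ≡⟨ cong (λ x → (x + b % m) % m) (m%n%n≡m%n (toℕ j + a) m) ⟩
    ((toℕ j + a) % m + b % m) % m         ≡⟨ %-distribˡ-+ (toℕ j + a) b m ⟨
    (toℕ j + a + b) % m                   ≡⟨ cong (_% m) (+-assoc (toℕ j) a b) ⟩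
    (toℕ j + (a + b)) % m                 ≡⟨ toℕ-⊕ j (a + b) ⟨
    toℕ (j ⊕ (a + b))                     ∎)
    where
    open ≡-Reasoning
    instance _ = nonZeroIndex j

  ⊕-multiple : ∀ (j : Fin m) k → j ⊕ k * m ≡ j
  ⊕-multiple j k = toℕ-injective (begin
    toℕ (j ⊕ k * m)         ≡⟨ toℕ-⊕ j (k * m) ⟩
    (toℕ j + k * m) % m     ≡⟨ [m+kn]%n≡m%n (toℕ j) k m ⟩
    toℕ j % m               ≡⟨ m<n⇒m%n≡m (toℕ<n j) ⟩
    toℕ j                   ∎)
    where
    open ≡-Reasoning
    instance _ = nonZeroIndex j

  c+c*[m∸1] : Fin m → ∀ c → c + c * (m ∸ 1) ≡ c * m
  c+c*[m∸1] j c = trans (sym (*-suc c (m ∸ 1))) (cong (c *_) (suc-pred m {{nonZeroIndex j}}))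

  ⊕-⊖ : ∀ (j : Fin m) c → j ⊕ c ⊖ c ≡ j
  ⊕-⊖ j c = trans (⊕-⊕ j c _) (trans (cong (j ⊕_) (c+c*[m∸1] j c)) (⊕-multiple j c))

  ⊖-⊕ : ∀ (j : Fin m) c → j ⊖ c ⊕ c ≡ j
  ⊖-⊕ j c = trans (⊕-⊕ j _ c)
    (trans (cong (j ⊕_) (trans (+-comm _ c) (c+c*[m∸1] j c))) (⊕-multiple j c))

  ⊕-⊖-⊕ : ∀ (j : Fin m) c t → j ⊖ (c + t) ⊕ c ≡ j ⊖ t
  ⊕-⊖-⊕ j c t = begin
    j ⊖ (c + t) ⊕ c    ≡⟨ cong (λ x → j ⊕ x ⊕ c)
                            (trans (*-distribʳ-+ (m ∸ 1) c t) (+-comm (c * (m ∸ 1)) _)) ⟩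
    j ⊕ (t * (m ∸ 1) + c * (m ∸ 1)) ⊕ c ≡⟨ cong (_⊕ c) (⊕-⊕ j (t * (m ∸ 1)) _) ⟨
    j ⊖ t ⊖ c ⊕ c      ≡⟨ ⊖-⊕ (j ⊖ t) c ⟩
    j ⊖ t              ∎
    where open ≡-Reasoning

  -- The step count is the residue of `j - i`, an element of `Fin m` and hence below `m`.
  ⊕-transitive : ∀ (i j : Fin m) → ∃[ t ] t < m × i ⊕ t ≡ j
  ⊕-transitive i j = toℕ y , toℕ<n y , (begin
    i ⊕ toℕ y    ≡⟨ toℕ-injective (begin
      toℕ (i ⊕ toℕ y)        ≡⟨ toℕ-⊕ i (toℕ y) ⟩
      (toℕ i + toℕ y) % m    ≡⟨ cong (_% m) (+-comm (toℕ i) (toℕ y)) ⟩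
      (toℕ y + toℕ i) % m    ≡⟨ toℕ-⊕ y (toℕ i) ⟨
      toℕ (y ⊕ toℕ i)        ∎) ⟩
    y ⊕ toℕ i    ≡⟨ ⊖-⊕ j (toℕ i) ⟩
    j            ∎)
    where
    open ≡-Reasoning
    y = j ⊖ toℕ i
    instance _ = nonZeroIndex j

  ⊖-transitive : ∀ (i j : Fin m) → ∃[ t ] t < m × i ⊖ t ≡ j
  ⊖-transitive i j with t , t<m , j⊕t≡i ← ⊕-transitive j i =
    t , t<m , trans (cong (_⊖ t) (sym j⊕t≡i)) (⊕-⊖ j t)

  -- Frames of the Knödel graph

  ascending : Fin m → Frame G m
  ascending j = record
    { P     = λ t → inj₁ (j ⊕ t)
    ; Q     = λ t → inj₂ (j ⊕ t)
    ; adj₀  = λ t → zero , link 0 t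
    ; adj₁  = λ t → suc zero , link 1 t
    ; adj₃  = λ t → suc (suc zero) , link 3 t
    ; cover = λ where
        (inj₁ i) → let t , t<m , eq = ⊕-transitive j i
                   in t , t<m , inj₁ (cong inj₁ (sym eq))
        (inj₂ i) → let t , t<m , eq = ⊕-transitive (j ⊕ 1) i
                   in t , t<m , inj₂ (cong inj₂ (trans (sym eq) (⊕-⊕ j 1 t)))
    }
    where
    link : ∀ c t → j ⊕ (c + t) ≡ j ⊕ t ⊕ c
    link c t = trans (cong (j ⊕_) (+-comm c t)) (sym (⊕-⊕ j t c))

  -- Since `(2 , j)` is adjacent to `(1 , j - c)` for c = 0, 1, 3, reversing the direction exchanges
  -- the two sides. One tiling argument thus serves a deleted vertex on either side.
  descending : Fin m → Frame G m
  descending j = record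
    { P     = λ t → inj₂ (j ⊖ t)
    ; Q     = λ t → inj₁ (j ⊖ t)
    ; adj₀  = λ t → zero , sym (⊕-⊖-⊕ j 0 t)
    ; adj₁  = λ t → suc zero , sym (⊕-⊖-⊕ j 1 t)
    ; adj₃  = λ t → suc (suc zero) , sym (⊕-⊖-⊕ j 3 t)
    ; cover = λ where
        (inj₂ i) → let t , t<m , eq = ⊖-transitive j i
                   in t , t<m , inj₁ (cong inj₂ (sym eq))
        -- Going forward by `m ∸ 1` is one step back, so the walk starts at `Q 1`.
        (inj₁ i) → let t , t<m , eq = ⊖-transitive (j ⊕ (m ∸ 1)) i
                   in t , t<m , inj₂ (cong inj₁ (trans (sym eq) (⊕-⊕ j (m ∸ 1) _)))
    }

  frameThrough : ∀ t (u : Vertex G) → ∃[ F ] Frame.P {G} {m} F t ≡ u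
  frameThrough t (inj₁ j) = ascending (j ⊖ t) , cong inj₁ (⊖-⊕ j t)
  frameThrough t (inj₂ j) = descending (j ⊕ t) , cong inj₂ (⊕-⊖ j t)

  -- Closed neighbourhoods counted on each side

  left right : Vertex G → List (Fin m)
  left  (inj₁ j) = j ∷ []
  left  (inj₂ j) = j ⊖ 0 ∷ j ⊖ 1 ∷ j ⊖ 3 ∷ []
  right (inj₁ j) = j ⊕ 0 ∷ j ⊕ 1 ∷ j ⊕ 3 ∷ []
  right (inj₂ j) = j ∷ []

  ∈-right : ∀ d → Adj G (inj₂ j) d → j ∈ right d
  ∈-right (inj₁ _) (zero , refl)           = here refl
  ∈-right (inj₁ _) (suc zero , refl)       = there (here refl)
  ∈-right (inj₁ _) (suc (suc zero) , refl) = there (there (here refl))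

  ∈-left : ∀ d → Adj G (inj₁ j) d → j ∈ left d
  ∈-left {j} (inj₂ _) (zero , refl)           = here (sym (⊕-⊖ j 0))
  ∈-left {j} (inj₂ _) (suc zero , refl)       = there (here (sym (⊕-⊖ j 1)))
  ∈-left {j} (inj₂ _) (suc (suc zero) , refl) = there (there (here (sym (⊕-⊖ j 3))))

  dominated-left : ∀ {D} → Dominated G D (inj₁ j) → j ∈ concatMap left D
  dominated-left (inj₁ v∈D)             = ∈-concatMap⁺ left (Any.map (λ { refl → here refl }) v∈D)
  dominated-left (inj₂ (d , d∈D , adj)) = ∈-concatMap⁺ left (lose d∈D (∈-left d adj))

  dominated-right : ∀ {D} → Dominated G D (inj₂ j) → j ∈ concatMap right D
  dominated-right (inj₁ v∈D)             = ∈-concatMap⁺ right (Any.map (λ { refl → here refl }) v∈D)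
  dominated-right (inj₂ (d , d∈D , adj)) = ∈-concatMap⁺ right (lose d∈D (∈-right d adj))

  -- Here `a` and `b` count the entries of `D` on the first and second side. An entry contributes
  -- one index to its own side and three to the other, and `a + 3b` is `length D + 2b`.
  side-lengths : ∀ D → ∃[ a ] ∃[ b ] a + b ≡ length D ×
    length (concatMap left D) ≡ length D + 2 * b ×
    length (concatMap right D) ≡ length D + 2 * a
  side-lengths []           = 0 , 0 , refl , refl , refl
  side-lengths (inj₁ _ ∷ D) with a , b , a+b , l , r ← side-lengths D =
    suc a , b , cong suc a+b , cong suc l ,
    trans (cong (3 +_) r) (eq (length D) a)
    where
    eq : ∀ x a → 3 + (x + 2 * a) ≡ suc x + 2 * suc a
    eq = solve-∀
  side-lengths (inj₂ _ ∷ D) with a , b , a+b , l , r ← side-lengths D =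
    a , suc b , trans (+-suc a b) (cong suc a+b) ,
    trans (cong (3 +_) l) (eq (length D) b) , cong suc r
    where
    eq : ∀ x a → 3 + (x + 2 * a) ≡ suc x + 2 * suc a
    eq = solve-∀

  -- Each entry of `D` contributes four indices in all; putting `u` in front of the list for its
  -- side makes the two lists cover all `2m` vertices.
  dominatesExcept⇒length≥ : ∀ u D → DominatesExcept G u D → 2 * m ≤ 1 + 4 * length D
  dominatesExcept⇒length≥ u D dom with side-lengths D
  ... | a , b , a+b≡ , l , r = case u dom
    where
    total : 1 + (length D + 2 * b) + (length D + 2 * a) ≡ 1 + 4 * length D
    total = trans (eq (length D) a b) (trans (cong (λ x → 1 + (2 * length D + 2 * x)) a+b≡) (eq′ (length D)))
      where
      eq : ∀ x a b → 1 + (x + 2 * b) + (x + 2 * a) ≡ 1 + (2 * x + 2 * (a + b))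
      eq = solve-∀
      eq′ : ∀ x → 1 + (2 * x + 2 * x) ≡ 1 + 4 * x
      eq′ = solve-∀
    open ≤-Reasoning
    case : ∀ u → DominatesExcept G u D → 2 * m ≤ 1 + 4 * length D
    case (inj₁ j) dom = begin
      2 * m                                          ≡⟨ cong (m +_) (+-identityʳ m) ⟩
      m + m                                          ≤⟨ +-mono-≤
        (covering⇒≤-length (j ∷ concatMap left D) coverˡ)
        (covering⇒≤-length (concatMap right D) λ i → dominated-right (dom (inj₂ i) λ ())) ⟩
      1 + length (concatMap left D) + length (concatMap right D) ≡⟨ cong₂ (λ x y → 1 + x + y) l r ⟩
      1 + (length D + 2 * b) + (length D + 2 * a)    ≡⟨ total ⟩
      1 + 4 * length D                               ∎
      where
      coverˡ : ∀ i → i ∈ j ∷ concatMap left D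
      coverˡ i with i ≟ᶠ j
      ... | yes i≡j = here i≡j
      ... | no  i≢j = there (dominated-left (dom (inj₁ i) λ { refl → i≢j refl }))
    case (inj₂ j) dom = begin
      2 * m                                          ≡⟨ cong (m +_) (+-identityʳ m) ⟩
      m + m                                          ≤⟨ +-mono-≤
        (covering⇒≤-length (concatMap left D) λ i → dominated-left (dom (inj₁ i) λ ()))
        (covering⇒≤-length (j ∷ concatMap right D) coverʳ) ⟩
      length (concatMap left D) + (1 + length (concatMap right D)) ≡⟨ +-suc (length (concatMap left D)) _ ⟩
      1 + length (concatMap left D) + length (concatMap right D) ≡⟨ cong₂ (λ x y → 1 + x + y) l r ⟩
      1 + (length D + 2 * b) + (length D + 2 * a)    ≡⟨ total ⟩
      1 + 4 * length D                               ∎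
      where
      coverʳ : ∀ i → i ∈ j ∷ concatMap right D
      coverʳ i with i ≟ᶠ j
      ... | yes i≡j = here i≡j
      ... | no  i≢j = there (dominated-right (dom (inj₂ i) λ { refl → i≢j refl }))

  -- Counting both sides together gives only `1 + q * 2`; the missing unit comes from rounding on
  -- each side separately.
  dominates⇒length≥ : ∀ q → m ≡ 2 + q * 4 → ∀ D → Dominates G D → 2 + q * 2 ≤ length D
  dominates⇒length≥ q m≡ D dom with side-lengths D
  ... | a , b , a+b≡ , l , r = ≮⇒≥ λ D< →
    <⇒≱ D< (subst₂ _≤_ (eq q) a+b≡ (+-mono-≤
      (half a (s≤s⁻¹ D<) (≤-trans (covering⇒≤-length _ λ i → dominated-right (dom (inj₂ i))) (≤-reflexive r)))
      (half b (s≤s⁻¹ D<) (≤-trans (covering⇒≤-length _ λ i → dominated-left (dom (inj₁ i))) (≤-reflexive l)))))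
    where
    eq : ∀ q → suc q + suc q ≡ 2 + q * 2
    eq = solve-∀
    eq′ : ∀ q → 2 + q * 4 ≡ 1 + q * 2 + (1 + 2 * q)
    eq′ = solve-∀
    half : ∀ a → length D ≤ 1 + q * 2 → m ≤ length D + 2 * a → q < a
    -- What remains is `1 + 2 * q ≤ 2 * a`, which is literally `2 * q < 2 * a`.
    half a D≤ m≤ = *-cancelˡ-< 2 q a (+-cancelˡ-≤ (1 + q * 2) _ _
      (subst (_≤ 1 + q * 2 + 2 * a) (trans m≡ (eq′ q)) (≤-trans m≤ (+-monoˡ-≤ (2 * a) D≤))))

  -- Criticality for each residue of `m` modulo 4

  small⇒¬critical : ∀ D → Vertex G → Dominates G D → 4 * length D < 3 + 2 * m →
    ¬ DominationCritical G
  small⇒¬critical D u dom 4D<3+2m crit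
    with k , k′ , γ , record { attained = D′ , domD′ , D′≡k′ } , k′<k ← crit u =
    <⇒≱ 4D<3+2m (begin
      3 + 2 * m                            ≤⟨ +-monoʳ-≤ 3 (dominatesExcept⇒length≥ u (map value D′)
                                                (map-value-dominates G _≟ⱽ_ u
                                                  (isDominatingSet⇒Dominates (G - u) (≟ʳ _≟ⱽ_) domD′))) ⟩
      4 + 4 * length (map value D′)        ≡⟨ cong (λ x → 4 + 4 * x) (trans (length-map value D′) D′≡k′) ⟩
      4 + 4 * k′                           ≡⟨ *-suc 4 k′ ⟨
      4 * suc k′                           ≤⟨ *-monoʳ-≤ 4 k′<k ⟩
      4 * k                                ≤⟨ *-monoʳ-≤ 4 (minimal γ _ (deduplicate-isDominatingSet G _≟ⱽ_ dom)) ⟩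
      4 * length (deduplicate _≟ⱽ_ D)      ≤⟨ *-monoʳ-≤ 4 (length-deduplicate _≟ⱽ_ D) ⟩
      4 * length D                         ∎)
    where
    open ≤-Reasoning
    open IsDominationNumber

  m≡2⇒critical : ∀ q → m ≡ 2 + q * 4 → DominationCritical G
  -- The frame is placed so that `u` is `P (q * 4)`, the one vertex that the tiles miss.
  m≡2⇒critical q m≡ u with frameThrough (q * 4) u
  ... | F , refl = 2 + q * 2 , 1 + q * 2 ,
    mkIsDominationNumber G _≟ⱽ_ (2 + q * 2) (u ∷ D) domG
      (≤-reflexive (cong suc length-D)) (dominates⇒length≥ q m≡) ,
    mkIsDominationNumber (G - u) (≟ʳ _≟ⱽ_) (1 + q * 2) (restrict G _≟ⱽ_ u D≢u)
      (restrict-dominates G _≟ⱽ_ u D≢u domD)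
      (≤-reflexive (trans (length-restrict G _≟ⱽ_ u D≢u) length-D))
      lower ,
    n<1+n (1 + q * 2)
    where
    open Frame F
    D = tile (suc q) q

    length-D : length D ≡ 1 + q * 2
    length-D = trans (length-tile (suc q) q) (eq q)
      where
      eq : ∀ q → suc q + q ≡ 1 + q * 2
      eq = solve-∀

    domD : DominatesExcept G u D
    domD = tile-dominates₂ q (≤-reflexive m≡)

    domG : Dominates G (u ∷ D)
    domG v with v ≟ⱽ u
    ... | yes v≡u = inj₁ (here v≡u)
    ... | no  v≢u = Dominated-∷ u (domD v v≢u)

    -- If u were in D, then D would dominate G, but it is too small.
    u∉D : u ∉ D
    u∉D u∈D = <⇒≱ (n<1+n (1 + q * 2)) (subst (2 + q * 2 ≤_) length-D (dominates⇒length≥ q m≡ D dom))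
      where
      dom : Dominates G D
      dom v with v ≟ⱽ u
      ... | yes refl = inj₁ u∈D
      ... | no  v≢u  = domD v v≢u

    D≢u : All (_≢ u) D
    D≢u = All.map (λ u≢v v≡u → u≢v (sym v≡u)) (¬Any⇒All¬ D u∉D)

    lower : ∀ E → Dominates (G - u) E → 1 + q * 2 ≤ length E
    -- Counting gives `3 + 8q ≤ 4 * length E`; giving away 2 leaves the strict inequality from which
    -- 4 cancels.
    lower E domE = *-cancelˡ-< 4 (q * 2) (length E) (≤-trans (m≤n+m _ 2) (s≤s⁻¹ (begin
      4 + 4 * (q * 2)               ≡⟨ trans (eq q) (cong (2 *_) (sym m≡)) ⟩
      2 * m                         ≤⟨ dominatesExcept⇒length≥ u (map value E) (map-value-dominates G _≟ⱽ_ u domE) ⟩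
      1 + 4 * length (map value E)  ≡⟨ cong (λ x → 1 + 4 * x) (length-map value E) ⟩
      1 + 4 * length E              ∎)))
      where
      open ≤-Reasoning
      eq : ∀ q → 4 + 4 * (q * 2) ≡ 2 * (2 + q * 4)
      eq = solve-∀

  private
    4[q+q]≡ : ∀ q → 4 * (q + q) ≡ 2 * (q * 4)
    4[q+q]≡ = solve-∀

  m≡0⇒¬critical : ∀ q → m ≡ q * 4 → Vertex G → ¬ DominationCritical G
  m≡0⇒¬critical q m≡ u with F , _ ← frameThrough 0 u =
    small⇒¬critical (tile q q) u (tile-dominates q (≤-reflexive m≡)) (begin-strict
      4 * length (tile q q)    ≡⟨ cong (4 *_) (length-tile q q) ⟩
      4 * (q + q)              ≡⟨ 4[q+q]≡ q ⟩
      2 * (q * 4)              <⟨ m≤n+m _ 2 ⟩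
      3 + 2 * (q * 4)          ≡⟨ cong (λ x → 3 + 2 * x) m≡ ⟨
      3 + 2 * m                ∎)
    where
    open ≤-Reasoning
    open Frame F

  m≡1⇒¬critical : ∀ q → m ≡ 1 + q * 4 → Vertex G → ¬ DominationCritical G
  m≡1⇒¬critical q m≡ u with F , _ ← frameThrough 0 u =
    small⇒¬critical (P (q * 4) ∷ tile q q) u (tile-dominates₁ q (≤-reflexive m≡)) (begin-strict
      4 * suc (length (tile q q))    ≡⟨ cong (λ x → 4 * suc x) (length-tile q q) ⟩
      4 * suc (q + q)                <⟨ n<1+n _ ⟩
      1 + 4 * suc (q + q)            ≡⟨ eq q ⟩
      3 + 2 * (1 + q * 4)            ≡⟨ cong (λ x → 3 + 2 * x) m≡ ⟨
      3 + 2 * m                      ∎)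
    where
    open ≤-Reasoning
    open Frame F
    eq : ∀ q → 1 + 4 * suc (q + q) ≡ 3 + 2 * (1 + q * 4)
    eq = solve-∀

  m≡3⇒¬critical : ∀ q → m ≡ 3 + q * 4 → Vertex G → ¬ DominationCritical G
  m≡3⇒¬critical q m≡ u with F , _ ← frameThrough 0 u =
    small⇒¬critical (tile (suc q) (suc q)) u
      -- Here `m` is one short of `suc q` full blocks, and `4 * length D = 8q + 8` stays just below
      -- `3 + 2 * m = 8q + 9`.
      (tile-dominates (suc q) (≤-trans (≤-reflexive m≡) (n≤1+n _))) (begin-strict
      4 * length (tile (suc q) (suc q))    ≡⟨ cong (4 *_) (length-tile (suc q) (suc q)) ⟩
      4 * (suc q + suc q)                  <⟨ n<1+n _ ⟩
      1 + 4 * (suc q + suc q)              ≡⟨ eq q ⟩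
      3 + 2 * (3 + q * 4)                  ≡⟨ cong (λ x → 3 + 2 * x) m≡ ⟨
      3 + 2 * m                            ∎)
    where
    open ≤-Reasoning
    open Frame F
    eq : ∀ q → 1 + 4 * (suc q + suc q) ≡ 3 + 2 * (3 + q * 4)
    eq = solve-∀

  -- The vertex rules out the empty graph, which is vacuously critical.
  critical⇔m%4≡2 : Vertex G → DominationCritical G ⇔ m % 4 ≡ 2
  critical⇔m%4≡2 u = mk⇔ (to (m % 4) (m%n<n m 4) m≡)
    (λ r≡2 → m≡2⇒critical q (trans m≡ (cong (_+ q * 4) r≡2)))
    where
    q = m / 4
    m≡ = m≡m%n+[m/n]*n m 4
    to : ∀ r → r < 4 → m ≡ r + q * 4 → DominationCritical G → r ≡ 2
    to 0 _ eq crit = contradiction crit (m≡0⇒¬critical q eq u)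
    to 1 _ eq crit = contradiction crit (m≡1⇒¬critical q eq u)
    to 2 _ _  _    = refl
    to 3 _ eq crit = contradiction crit (m≡3⇒¬critical q eq u)
    to (suc (suc (suc (suc _)))) (s≤s (s≤s (s≤s (s≤s ())))) _ _

theorem3p1 : (n : ℕ) → 8 ≤ n → 2 ∣ n →
    DominationCritical (Knödel 3 n) ⇔ n % 8 ≡ 4
theorem3p1 n 8≤n 2∣n = mk⇔
  (λ crit → trans n%8≡ (cong (_* 2) (Equivalence.to iff crit)))
  (λ n%8≡4 → Equivalence.from iff (*-cancelʳ-≡ (n / 2 % 4) 2 2 (trans (sym n%8≡) n%8≡4)))
  where
  iff = critical⇔m%4≡2 n (inj₁ (fromℕ< (≤-trans (s≤s z≤n) (/-monoˡ-≤ 2 8≤n))))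

  -- For even `n`, doubling carries residue 2 of `n / 2` modulo 4 to residue 4 of `n` modulo 8.
  n%8≡ : n % 8 ≡ n / 2 % 4 * 2
  n%8≡ = trans (cong (_% 8) (sym (m/n*n≡m 2∣n))) (sym (m%n*o≡m*o%[n*o] (n / 2) 4 2))
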